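{- Let $k\ge2$ and let $\alpha(y_1,\dots,y_k)=c\oplus y_1\oplus\cdots\oplus y_k$, with $c\in GF(2)$, be a linear $k$-adic connective. Consider the growth process $(\mu,\alpha)$ on $n$ variables and assume that the support of $\mu$ contains the negations of the projections. (1) If $\{0,1\}\cap\mathrm{supp}(\mu)=\emptyset$ (no constant function is in the support of $\mu$) and $k$ is odd, then the limiting distribution is uniform over all linear functions of an odd number of variables. (2) If $\{0,1\}\cap\mathrm{supp}(\mu)=\emptyset$ and $k$ is even, then the limiting distribution is uniform over all linear functions of an even number of variables. (3) Otherwise, the limiting distribution is uniform over the set of all $n$-adic linear functions.
   Context: A connective is a $k$-adic Boolean function $\alpha:\{0,1\}^k\to\{0,1\}$. Let $A_0=\{x_1,\dots,x_n,\bar x_1,\dots,\bar x_n,0,1\}$ be the set of projections on $n$ variables, their negations, and the two constant functions. The initial distribution $\mu$ is the uniform distribution on a subset of $A_0$ which contains the $n$ projections, may or may not contain their $n$ negations, and contains neither, one, or both constants. The growth process $(\mu,\alpha)$ gives distributions $\pi_i$ on $n$-adic Boolean functions: $\pi_0=\mu$, and for $i\ge1$, $\pi_i(f)$ is the probability that $\alpha(g_1,\dots,g_k)=f$ where $g_1,\dots,g_k$ are independent random functions distributed according to $\pi_{i-1}$. The support of $\mu$ is $\mathrm{supp}(\mu)=\{f:\mu(f)>0\}$. The limiting distribution is $\pi=\lim_{i\to\infty}\pi_i$ (pointwise); the statement includes that it exists. A function is linear if it has the form $c_0\oplus c_1x_1\oplus\cdots\oplus c_nx_n$ with $c_j\in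 GF(2)$; it is a linear function of an odd (even) number of variables if the number of indices $j\in\{1,\dots,n\}$ with $c_j=1$ is odd (even). -}

module Defs where

open import Level using (0ℓ)
open import Data.Bool using (Bool; true; false; not; _∧_; _xor_)
import Data.Bool.Properties as Bool
open import Data.Fin using (Fin)
open import Data.Fin.Subset using (∣_∣)
open import Data.List using (List; []; _∷_; cartesianProductWith; filter; foldr)
import Data.List as List
open import Data.Nat using (ℕ; zero; suc)
import Data.Nat as ℕ
open import Data.Nat.Divisibility using (_∣_; _∤_)
open import Data.Product using (∃; ∃₂; _×_; _,_)
open import Data.Rational using (ℚ; 0ℚ; 1ℚ; _+_; _*_; _-_; _≤_; _<_)
import Data.Rational as ℚ
open import Data.Sum using (_⊎_)
open import Data.Vec using (Vec; []; _∷_; lookup; zipWith)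
import Data.Vec as Vec
open import Function using (_∘_; const)
open import Relation.Binary.Core using (_Preserves_⟶_)
open import Relation.Binary.PropositionalEquality using (_≡_; _≗_)
open import Relation.Nullary using (Dec)
open import Relation.Nullary.Decidable using (map′; _×-dec_)
open import Relation.Unary using (Pred; _∈_; _∉_; _⊆_)

-- Boolean functions are compared by pointwise equality _≗_ throughout,
-- since function extensionality is not available.
BoolFun : ℕ → Set
BoolFun n = Vec Bool n → Bool

private
  variable
    n k : ℕ

infix 4 _≗?_

_≗?_ : (f g : BoolFun n) → Dec (f ≗ g)
_≗?_ {zero}  f g =
  map′ (λ eq → λ { [] → eq }) (λ eq → eq []) (f [] Bool.≟ g [])
_≗?_ {suc n} f g =
  map′ (λ (eq₁ , eq₀) → λ { (true ∷ x) → eq₁ x ; (false ∷ x) → eq₀ x })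
       (λ eq → (λ x → eq (true ∷ x)) , (λ x → eq (false ∷ x)))
       ((f ∘ (true ∷_) ≗? g ∘ (true ∷_)) ×-dec
        (f ∘ (false ∷_) ≗? g ∘ (false ∷_)))

branch : BoolFun n → BoolFun n → BoolFun (suc n)
branch f₁ f₀ (true  ∷ x) = f₁ x
branch f₁ f₀ (false ∷ x) = f₀ x

-- Every n-adic Boolean function is pointwise equal to exactly one entry.
allBoolFuns : ∀ n → List (BoolFun n)
allBoolFuns zero    = const false ∷ const true ∷ []
allBoolFuns (suc n) = cartesianProductWith branch (allBoolFuns n) (allBoolFuns n)

tuples : ∀ {A : Set} k → List A → List (Vec A k)
tuples zero    xs = [] ∷ []
tuples (suc k) xs = cartesianProductWith _∷_ xs (tuples k xs)

var : Fin n → BoolFun n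
var j x = lookup x j

negVar : Fin n → BoolFun n
negVar j x = not (lookup x j)

A₀ : Pred (BoolFun n) 0ℓ
A₀ f = (∃ λ j → f ≗ var j) ⊎ (∃ λ j → f ≗ negVar j) ⊎ (∃ λ b → f ≗ const b)

⨁ : Vec Bool n → Bool
⨁ = Vec.foldr′ _xor_ false

affine : Bool → Vec Bool n → BoolFun n
affine c₀ c x = c₀ xor ⨁ (zipWith _∧_ c x)

Linear : Pred (BoolFun n) 0ℓ
Linear f = ∃₂ λ c₀ c → f ≗ affine c₀ c

-- A coefficient vector is read as the subset of indices j with cⱼ = 1,
-- so ∣ c ∣ is the number of variables that occur.
OddLinear : Pred (BoolFun n) 0ℓ
OddLinear f = ∃₂ λ c₀ c → 2 ∤ ∣ c ∣ × f ≗ affine c₀ c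

EvenLinear : Pred (BoolFun n) 0ℓ
EvenLinear f = ∃₂ λ c₀ c → 2 ∣ ∣ c ∣ × f ≗ affine c₀ c

sumℚ : List ℚ → ℚ
sumℚ = foldr _+_ 0ℚ

Mass : ℕ → Set
Mass n = BoolFun n → ℚ

record IsDistribution (p : Mass n) : Set where
  field
    respects-≗  : p Preserves _≗_ ⟶ _≡_
    nonNegative : ∀ f → 0ℚ ≤ p f
    total       : sumℚ (List.map p (allBoolFuns n)) ≡ 1ℚ

supp : Mass n → Pred (BoolFun n) 0ℓ
supp p f = 0ℚ < p f

record IsUniformOn (S : Pred (BoolFun n) 0ℓ) (p : Mass n) : Set where
  field
    isDistribution : IsDistribution p
    constant       : ∀ {f g} → f ∈ S → g ∈ S → p f ≡ p g
    outside        : ∀ {f} → f ∉ S → p f ≡ 0ℚ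

record IsInitial (μ : Mass n) : Set₁ where
  field
    S         : Pred (BoolFun n) 0ℓ
    S⊆A₀      : S ⊆ A₀
    vars      : ∀ j → var j ∈ S
    negVars   : (∀ j → negVar j ∈ S) ⊎ (∀ j → negVar j ∉ S)
    isUniform : IsUniformOn S μ

compose : BoolFun k → Vec (BoolFun n) k → BoolFun n
compose α gs x = α (Vec.map (λ g → g x) gs)

-- By independence, the tuple (g₁ , … , gₖ) has probability p g₁ * … * p gₖ.
tupleProbability : Mass n → Vec (BoolFun n) k → ℚ
tupleProbability p gs = Vec.foldr′ _*_ 1ℚ (Vec.map p gs)

growth : Mass n → BoolFun k → ℕ → Mass n
growth         μ α zero    = μ
growth {n} {k} μ α (suc i) f =
  sumℚ (List.map (tupleProbability (growth μ α i))
         (filter (λ gs → compose α gs ≗? f) (tuples k (allBoolFuns n))))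

_⟶_ : (ℕ → ℚ) → ℚ → Set
a ⟶ l = ∀ ε → 0ℚ < ε → ∃ λ N → ∀ i → N ℕ.≤ i → ℚ.∣ a i - l ∣ < ε

-- The existence of the pointwise limit is part of this predicate.
LimitUniformOn : Pred (BoolFun n) 0ℓ → Mass n → BoolFun k → Set
LimitUniformOn S μ α =
  ∃ λ π → (∀ f → (λ i → growth μ α i f) ⟶ π f) × IsUniformOn S π

NoConstantInSupport : Mass n → Set
NoConstantInSupport μ = ∀ b → const b ∉ supp μ

{-# OPTIONS --safe #-}
module Submission where

-- The proof is Fourier analysis on the group of all n-adic Boolean functions, with xor as
-- addition. Its characters are χ t f = (-1)^⟨t,f⟩, where t is again a Boolean function and ⟨t,f⟩ is
-- the parity of the number of points at which both t and f are true. The Walsh transform of a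
-- mass p is walsh p t = ∑ χ t f * p f, summed over all f.
--
-- Since α adds its arguments and the constant c, one growth step is a convolution: up to the sign
-- χ t c it raises each Fourier coefficient to the k-th power (walsh-growth). Hence a coefficient
-- whose initial value lies strictly between -1 and 1 tends to 0 when k ≥ 2 (walsh⟶0). This
-- happens for every t such that ⟨t,·⟩ is not constant on the support of μ (∣walsh∣<1). All
-- remaining t satisfy ⟨t,1⟩ = 0 and have a common value a = ⟨t,xⱼ⟩ for all j (Balanced,
-- spectrum); if a constant function is in the support, then moreover a = 0 (spectrum-const). For
-- such t the pairing of t with an affine function is a times the parity of its number of
-- variables (pair-affine).
--
-- After at most one step the process lives on the target set S of affine functions
-- (growth-affine). Indeed, sums of affine functions are affine; adding k functions of an odd
-- number of variables gives one of an odd number when k is odd, and of an even number when k is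
-- even, and evenness persists. So for each t either the coefficient tends to 0 or ⟨t,·⟩ is
-- constant on S, in which case the coefficient is eventually that constant sign. In both cases
-- the coefficients converge, and by Fourier inversion so do the distributions. The limit is
-- constant on S because each nonvanishing term of the inversion formula is, and it vanishes
-- outside S as the distributions eventually do (spectral-limit).
--
-- Membership in the set on which μ is uniform need not be decidable, so support conditions are
-- phrased as vanishing outside a set, and decidable properties of rationals replace case
-- distinctions on membership.

open import Defs
open import Algebra.Bundles using (CommutativeRing)
import Algebra.Properties.CommutativeSemigroup as CommutativeSemigroupProperties
open import Data.Bool using (Bool; true; false; not; _∧_; _xor_; if_then_else_)
import Data.Bool.Properties as Bool
open import Data.Fin using (Fin; zero; suc)
import Data.Fin.Properties as Fin
open import Data.Fin.Subset using (⁅_⁆) renaming (∣_∣ to ∣_∣ˢ; ⊥ to ∅)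
open import Data.Integer using (+_; +[1+_]; -[1+_])
import Data.Integer as ℤ
import Data.Integer.Properties as ℤ
open import Data.List using (List; []; _∷_; _++_; filter; cartesianProductWith)
import Data.List as List
import Data.List.Properties as List
open import Data.Nat using (ℕ; zero; suc; _≤_; s≤s)
import Data.Nat as ℕ
import Data.Nat.Coprimality as ℕ
import Data.Nat.Properties as ℕ
open import Data.Nat.Divisibility using (_∣_; _∤_; _∣0; ∣-refl; ∣m∣n⇒∣m+n; ∣m+n∣m⇒∣n; ∣⇒≤)
open import Data.Product using (∃; ∃₂; _×_; _,_; proj₁; proj₂)
open import Data.Rational
  using (ℚ; mkℚ; 0ℚ; 1ℚ; ½; _+_; _*_; _-_; -_; _<_; _≤?_; _<?_; ∣_∣; toℚᵘ)
import Data.Rational as ℚ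
open import Data.Rational.Properties
open import Data.Rational.Solver using (module +-*-Solver)
open import Data.Rational.Unnormalised using (*≤*; *≡*)
import Data.Rational.Unnormalised.Properties as ℚᵘ
open import Data.Sum using (_⊎_; inj₁; inj₂; [_,_]′)
open import Data.Unit using (tt)
open import Data.Vec using (Vec; []; _∷_; zipWith; tabulate)
import Data.Vec as Vec
import Data.Vec.Properties as Vec
open import Data.Vec.Relation.Unary.All using (All; []; _∷_)
open import Function using (_∘_; const)
open import Level using (0ℓ)
open import Relation.Binary.Core using (_Preserves_⟶_)
open import Relation.Binary.PropositionalEquality
open import Relation.Nullary using (¬_; does; yes; no; contradiction)
open import Relation.Unary using (Pred; Decidable; _∈_; _∉_; _⊆_; U)

open import Algebra.Definitions.RawSemiring ℚ.+-*-rawSemiring using (_^_)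
open CommutativeSemigroupProperties
  (CommutativeRing.+-commutativeSemigroup Bool.xor-∧-commutativeRing)
  using () renaming (interchange to xor-interchange)
open +-*-Solver using (solve; _:+_; _:*_; _:-_; :-_; _:=_; con)
open IsDistribution

private
  variable
    A B C : Set
    n k : ℕ
    a b : ℕ → ℚ
    l m : ℚ

-- Rational arithmetic

0≤1 : 0ℚ ℚ.≤ 1ℚ
0≤1 = nonNegative⁻¹ 1ℚ

*-nonNeg : ∀ {p q} → 0ℚ ℚ.≤ p → 0ℚ ℚ.≤ q → 0ℚ ℚ.≤ p * q
*-nonNeg {p} {q} 0≤p 0≤q =
  subst (ℚ._≤ p * q) (*-zeroʳ p) (*-monoˡ-≤-nonNeg p {{ℚ.nonNegative 0≤p}} 0≤q)

*-mono-≤ : ∀ {p q r s} → 0ℚ ℚ.≤ r → 0ℚ ℚ.≤ q → p ℚ.≤ q → r ℚ.≤ s → p * r ℚ.≤ q * s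
*-mono-≤ {p} {q} {r} {s} 0≤r 0≤q p≤q r≤s =
  ≤-trans (*-monoʳ-≤-nonNeg r {{ℚ.nonNegative 0≤r}} p≤q)
          (*-monoˡ-≤-nonNeg q {{ℚ.nonNegative 0≤q}} r≤s)

*-pos : ∀ {p q} → 0ℚ < p → 0ℚ < q → 0ℚ < p * q
*-pos {p} {q} 0<p 0<q =
  subst (_< p * q) (*-zeroʳ p) (*-monoʳ-<-pos p {{ℚ.positive 0<p}} 0<q)

p<q⇒0<q-p : ∀ {p q} → p < q → 0ℚ < q - p
p<q⇒0<q-p {p} {q} p<q = subst (_< q - p) (+-inverseʳ p) (+-monoˡ-< (- p) p<q)

p≢q⇒0<∣p-q∣ : ∀ {p q} → p ≢ q → 0ℚ < ∣ p - q ∣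
p≢q⇒0<∣p-q∣ {p} {q} p≢q with 0ℚ <? ∣ p - q ∣
... | yes lt = lt
... | no ¬lt = contradiction (begin
    p            ≡⟨ solve 2 (λ p q → p := (p :- q) :+ q) refl p q ⟩
    (p - q) + q  ≡⟨ cong (_+ q) (∣p∣≡0⇒p≡0 (p - q) (≤-antisym (≮⇒≥ ¬lt) (0≤∣p∣ (p - q)))) ⟩
    0ℚ + q       ≡⟨ +-identityˡ q ⟩
    q            ∎) p≢q
  where open ≡-Reasoning

p≤∣p∣ : ∀ p → p ℚ.≤ ∣ p ∣
p≤∣p∣ p with ≤-total 0ℚ p
... | inj₁ 0≤p = ≤-reflexive (sym (0≤p⇒∣p∣≡p 0≤p))
... | inj₂ p≤0 = ≤-trans p≤0 (0≤∣p∣ p)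

∣p∣<r : ∀ {p r} → p < r → - p < r → ∣ p ∣ < r
∣p∣<r {p} {r} p<r -p<r with ∣p∣≡p∨∣p∣≡-p p
... | inj₁ eq = subst (_< r) (sym eq) p<r
... | inj₂ eq = subst (_< r) (sym eq) -p<r

-- The natural number i as a rational.
ι : ℕ → ℚ
ι i = mkℚ (+ i) 0 (ℕ.sym (ℕ.1-coprimeTo i))

ι-suc : ∀ i → ι (suc i) ≡ 1ℚ + ι i
ι-suc i = toℚᵘ-injective (ℚᵘ.≃-trans
  (*≡* (cong (λ z → (+ 1 ℤ.+ z) ℤ.* + 1) (sym (ℤ.*-identityʳ (+ i)))))
  (ℚᵘ.≃-sym (toℚᵘ-homo-+ 1ℚ (ι i))))

0≤ι : ∀ i → 0ℚ ℚ.≤ ι i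
0≤ι i = nonNegative⁻¹ (ι i)

ι-mono : ∀ {i j} → i ≤ j → ι i ℚ.≤ ι j
ι-mono i≤j = toℚᵘ-cancel-≤ (*≤* (ℤ.*-monoʳ-≤-nonNeg (+ 1) (ℤ.+≤+ i≤j)))

-- The denominator of p is a possible multiplier, since the numerator is at least 1.
archimedean : ∀ p → 0ℚ < p → ∃ λ i → 1ℚ ℚ.≤ ι i * p
archimedean p@(mkℚ +[1+ a ] d _) _ = suc d , toℚᵘ-cancel-≤
  (ℚᵘ.≤-respʳ-≃ (ℚᵘ.≃-sym (toℚᵘ-homo-* (ι (suc d)) p)) (*≤* (ℤ.+≤+ (begin
    1 ℕ.* (1 ℕ.* suc d)      ≡⟨ trans (ℕ.*-identityˡ _) (ℕ.*-identityˡ _) ⟩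
    suc d                    ≤⟨ ℕ.m≤m*n (suc d) (suc a) ⟩
    suc d ℕ.* suc a          ≡⟨ ℕ.*-identityʳ _ ⟨
    suc d ℕ.* suc a ℕ.* 1    ∎))))
  where open ℕ.≤-Reasoning
archimedean (mkℚ (+ 0) _ _)    0<p = contradiction (ℚ.positive 0<p) λ ()
archimedean (mkℚ -[1+ _ ] _ _) 0<p = contradiction (ℚ.positive 0<p) λ ()

1^k≡1 : ∀ k → 1ℚ ^ k ≡ 1ℚ
1^k≡1 zero    = refl
1^k≡1 (suc k) = trans (*-identityˡ _) (1^k≡1 k)

∣^∣≤1 : ∀ {p} → ∣ p ∣ ℚ.≤ 1ℚ → ∀ k → ∣ p ^ k ∣ ℚ.≤ 1ℚ
∣^∣≤1 {p} ∣p∣≤1 zero    = ≤-refl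
∣^∣≤1 {p} ∣p∣≤1 (suc k) = begin
  ∣ p * p ^ k ∣      ≡⟨ ∣p*q∣≡∣p∣*∣q∣ p (p ^ k) ⟩
  ∣ p ∣ * ∣ p ^ k ∣  ≤⟨ *-mono-≤ (0≤∣p∣ (p ^ k)) 0≤1 ∣p∣≤1 (∣^∣≤1 {p} ∣p∣≤1 k) ⟩
  1ℚ                 ∎
  where open ≤-Reasoning

∣^∣≤square : ∀ {p k} → ∣ p ∣ ℚ.≤ 1ℚ → 2 ≤ k → ∣ p ^ k ∣ ℚ.≤ ∣ p ∣ * ∣ p ∣
∣^∣≤square {p} {suc (suc k)} ∣p∣≤1 _ = begin
  ∣ p * (p * p ^ k) ∣          ≡⟨ ∣p*q∣≡∣p∣*∣q∣ p _ ⟩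
  ∣ p ∣ * ∣ p * p ^ k ∣        ≡⟨ cong (∣ p ∣ *_) (∣p*q∣≡∣p∣*∣q∣ p (p ^ k)) ⟩
  ∣ p ∣ * (∣ p ∣ * ∣ p ^ k ∣)  ≤⟨ scale (scale (∣^∣≤1 {p} ∣p∣≤1 k)) ⟩
  ∣ p ∣ * (∣ p ∣ * 1ℚ)         ≡⟨ cong (∣ p ∣ *_) (*-identityʳ ∣ p ∣) ⟩
  ∣ p ∣ * ∣ p ∣                ∎
  where
  open ≤-Reasoning
  scale : ∀ {q r} → q ℚ.≤ r → ∣ p ∣ * q ℚ.≤ ∣ p ∣ * r
  scale = *-monoˡ-≤-nonNeg ∣ p ∣ {{∣-∣-nonNeg p}}
∣^∣≤square {k = suc zero} _ (s≤s ())

-- Limits of rational sequences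

-- P holds from some index on.
Eventually : (ℕ → Set) → Set
Eventually P = ∃ λ N → ∀ i → N ≤ i → P i

⟶-const : Eventually (λ i → a i ≡ l) → a ⟶ l
⟶-const {l = l} (N , a≡l) ε 0<ε = N , λ i N≤i → subst (_< ε)
  (sym (trans (cong (λ x → ∣ x - l ∣) (a≡l i N≤i)) (cong ∣_∣ (+-inverseʳ l)))) 0<ε

⟶-cong : (∀ i → a i ≡ b i) → a ⟶ l → b ⟶ l
⟶-cong {l = l} a≡b a⟶l ε 0<ε = let N , close = a⟶l ε 0<ε in
  N , λ i N≤i → subst (λ x → ∣ x - l ∣ < ε) (a≡b i) (close i N≤i)

⟶-+ : a ⟶ l → b ⟶ m → (λ i → a i + b i) ⟶ (l + m)
⟶-+ {a} {l} {b} {m} a⟶l b⟶m ε 0<ε =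
  let 0<½ε = *-pos (positive⁻¹ ½) 0<ε
      M , closeₐ = a⟶l (½ * ε) 0<½ε
      N , closeᵦ = b⟶m (½ * ε) 0<½ε
  in M ℕ.⊔ N , λ i M⊔N≤i → begin-strict
    ∣ (a i + b i) - (l + m) ∣   ≡⟨ cong ∣_∣ (regroup (a i) (b i)) ⟩
    ∣ (a i - l) + (b i - m) ∣   ≤⟨ ∣p+q∣≤∣p∣+∣q∣ (a i - l) (b i - m) ⟩
    ∣ a i - l ∣ + ∣ b i - m ∣   <⟨ +-mono-< (closeₐ i (ℕ.≤-trans (ℕ.m≤m⊔n M N) M⊔N≤i))
                                            (closeᵦ i (ℕ.≤-trans (ℕ.m≤n⊔m M N) M⊔N≤i)) ⟩
    ½ * ε + ½ * ε               ≡⟨ solve 1 (λ ε → con ½ :* ε :+ con ½ :* ε := ε) refl ε ⟩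
    ε                           ∎
  where
  open ≤-Reasoning
  regroup : ∀ x y → (x + y) - (l + m) ≡ (x - l) + (y - m)
  regroup x y =
    solve 4 (λ x y l m → (x :+ y) :- (l :+ m) := (x :- l) :+ (y :- m)) refl x y l m

⟶-*-bounded : ∀ c → ∣ c ∣ ℚ.≤ 1ℚ → a ⟶ l → (λ i → c * a i) ⟶ (c * l)
⟶-*-bounded {a} {l} c ∣c∣≤1 a⟶l ε 0<ε = let N , close = a⟶l ε 0<ε in
  N , λ i N≤i → begin-strict
    ∣ c * a i - c * l ∣    ≡⟨ cong ∣_∣ (factor (a i)) ⟩
    ∣ c * (a i - l) ∣      ≡⟨ ∣p*q∣≡∣p∣*∣q∣ c (a i - l) ⟩
    ∣ c ∣ * ∣ a i - l ∣    ≤⟨ *-monoʳ-≤-nonNeg ∣ a i - l ∣ {{∣-∣-nonNeg (a i - l)}} ∣c∣≤1 ⟩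
    1ℚ * ∣ a i - l ∣       ≡⟨ *-identityˡ _ ⟩
    ∣ a i - l ∣            <⟨ close i N≤i ⟩
    ε                      ∎
  where
  open ≤-Reasoning
  factor : ∀ x → c * x - c * l ≡ c * (x - l)
  factor x = solve 3 (λ c x l → c :* x :- c :* l := c :* (x :- l)) refl c x l

limit-of-const : Eventually (λ i → a i ≡ m) → a ⟶ l → l ≡ m
limit-of-const {a} {m} {l} (M , a≡m) a⟶l with m ≟ l
... | yes m≡l = sym m≡l
... | no  m≢l = let N , close = a⟶l ∣ m - l ∣ (p≢q⇒0<∣p-q∣ m≢l) in contradiction
  (subst (λ x → ∣ x - l ∣ < ∣ m - l ∣) (a≡m (M ℕ.⊔ N) (ℕ.m≤m⊔n M N))
         (close (M ℕ.⊔ N) (ℕ.m≤n⊔m M N)))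
  (<-irrefl refl)

limit-nonNeg : (∀ i → 0ℚ ℚ.≤ a i) → a ⟶ l → 0ℚ ℚ.≤ l
limit-nonNeg {a} {l} 0≤a a⟶l with 0ℚ ≤? l
... | yes 0≤l = 0≤l
... | no  0≰l = let N , close = a⟶l (- l) (neg-antimono-< (≰⇒> 0≰l)) in
  contradiction (begin-strict
    - l              ≡⟨ +-identityˡ (- l) ⟨
    0ℚ - l           ≤⟨ +-monoˡ-≤ (- l) (0≤a N) ⟩
    a N - l          ≤⟨ p≤∣p∣ (a N - l) ⟩
    ∣ a N - l ∣      <⟨ close N ℕ.≤-refl ⟩
    - l              ∎) (<-irrefl refl)
  where open ≤-Reasoning

-- Bernoulli's inequality in the form ∣ a i ∣ * (1 + i * d) ≤ 1 with d = 1 - q gives the rate.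
⟶-geometric : ∀ {q} → 0ℚ ℚ.≤ q → q < 1ℚ → ∣ a 0 ∣ ℚ.≤ 1ℚ →
              (∀ i → ∣ a (suc i) ∣ ℚ.≤ q * ∣ a i ∣) → a ⟶ 0ℚ
⟶-geometric {a} {q} 0≤q q<1 ∣a₀∣≤1 shrinks ε 0<ε = N , close
  where
  open ≤-Reasoning
  d = 1ℚ - q
  0<d : 0ℚ < d
  0<d = p<q⇒0<q-p q<1
  0≤d = <⇒≤ 0<d

  0≤1+_*d : ∀ {x} → 0ℚ ℚ.≤ x → 0ℚ ℚ.≤ 1ℚ + x * d
  0≤1+ 0≤x *d = +-mono-≤ 0≤1 (*-nonNeg 0≤x 0≤d)

  0≤1+ι : ∀ i → 0ℚ ℚ.≤ 1ℚ + ι i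
  0≤1+ι i = +-mono-≤ 0≤1 (0≤ι i)

  expand : ∀ x j → q * x * (1ℚ + (1ℚ + j) * d) ≡ x * (1ℚ + j * d - d * d * (1ℚ + j))
  expand x j = solve 3 (λ q x j → let d = con 1ℚ :- q in
    q :* x :* (con 1ℚ :+ (con 1ℚ :+ j) :* d) :=
    x :* (con 1ℚ :+ j :* d :- d :* d :* (con 1ℚ :+ j))) refl q x j

  bound : ∀ i → ∣ a i ∣ * (1ℚ + ι i * d) ℚ.≤ 1ℚ
  bound zero = begin
    ∣ a 0 ∣ * (1ℚ + 0ℚ * d)
      ≡⟨ solve 2 (λ x d → x :* (con 1ℚ :+ con 0ℚ :* d) := x) refl ∣ a 0 ∣ d ⟩
    ∣ a 0 ∣
      ≤⟨ ∣a₀∣≤1 ⟩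
    1ℚ ∎
  bound (suc i) = begin
    ∣ a (suc i) ∣ * (1ℚ + ι (suc i) * d)
      ≡⟨ cong (λ x → ∣ a (suc i) ∣ * (1ℚ + x * d)) (ι-suc i) ⟩
    ∣ a (suc i) ∣ * (1ℚ + (1ℚ + ι i) * d)
      ≤⟨ *-monoʳ-≤-nonNeg _ {{ℚ.nonNegative (0≤1+ 0≤1+ι i *d)}} (shrinks i) ⟩
    q * ∣ a i ∣ * (1ℚ + (1ℚ + ι i) * d)
      ≡⟨ expand ∣ a i ∣ (ι i) ⟩
    ∣ a i ∣ * (1ℚ + ι i * d - d * d * (1ℚ + ι i))
      ≤⟨ *-monoˡ-≤-nonNeg ∣ a i ∣ {{∣-∣-nonNeg (a i)}}
           (+-monoʳ-≤ (1ℚ + ι i * d)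
             (neg-antimono-≤ (*-nonNeg (*-nonNeg 0≤d 0≤d) (0≤1+ι i)))) ⟩
    ∣ a i ∣ * (1ℚ + ι i * d - 0ℚ)
      ≡⟨ cong (∣ a i ∣ *_) (+-identityʳ (1ℚ + ι i * d)) ⟩
    ∣ a i ∣ * (1ℚ + ι i * d)
      ≤⟨ bound i ⟩
    1ℚ ∎

  arch : ∃ λ i → 1ℚ ℚ.≤ ι i * (d * ε)
  arch = archimedean (d * ε) (*-pos 0<d 0<ε)
  N = proj₁ arch

  close : ∀ i → N ≤ i → ∣ a i - 0ℚ ∣ < ε
  close i N≤i with ∣ a i ∣ <? ε
  ... | yes small = subst (λ x → ∣ x ∣ < ε) (sym (+-identityʳ (a i))) small
  ... | no ¬small = contradiction (begin-strict
    1ℚ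
      ≡⟨ +-identityˡ 1ℚ ⟨
    0ℚ + 1ℚ
      <⟨ +-mono-<-≤ 0<ε (proj₂ arch) ⟩
    ε + ι N * (d * ε)
      ≤⟨ +-monoʳ-≤ ε (*-monoʳ-≤-nonNeg (d * ε)
           {{ℚ.nonNegative (*-nonNeg 0≤d (<⇒≤ 0<ε))}} (ι-mono N≤i)) ⟩
    ε + ι i * (d * ε)
      ≡⟨ solve 3 (λ ε j d → ε :+ j :* (d :* ε) := ε :* (con 1ℚ :+ j :* d)) refl ε (ι i) d ⟩
    ε * (1ℚ + ι i * d)
      ≤⟨ *-monoʳ-≤-nonNeg _ {{ℚ.nonNegative (0≤1+ 0≤ι i *d)}} (≮⇒≥ ¬small) ⟩
    ∣ a i ∣ * (1ℚ + ι i * d)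
      ≤⟨ bound i ⟩
    1ℚ ∎) (<-irrefl refl)

-- As ∣ a i ∣ stays below ∣ a 0 ∣, each step shrinks by at least the factor ∣ a 0 ∣.
power-iteration⟶0 : 2 ≤ k → ∣ a 0 ∣ < 1ℚ → (∀ i → ∣ a (suc i) ∣ ≡ ∣ a i ^ k ∣) → a ⟶ 0ℚ
power-iteration⟶0 {k} {a} 2≤k ∣a₀∣<1 step =
  ⟶-geometric (0≤∣p∣ (a 0)) ∣a₀∣<1 (<⇒≤ ∣a₀∣<1) (λ i → shrinks i (bounded i))
  where
  open ≤-Reasoning
  shrinks : ∀ i → ∣ a i ∣ ℚ.≤ ∣ a 0 ∣ → ∣ a (suc i) ∣ ℚ.≤ ∣ a 0 ∣ * ∣ a i ∣
  shrinks i below = begin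
    ∣ a (suc i) ∣      ≡⟨ step i ⟩
    ∣ a i ^ k ∣        ≤⟨ ∣^∣≤square {a i} (≤-trans below (<⇒≤ ∣a₀∣<1)) 2≤k ⟩
    ∣ a i ∣ * ∣ a i ∣  ≤⟨ *-monoʳ-≤-nonNeg ∣ a i ∣ {{∣-∣-nonNeg (a i)}} below ⟩
    ∣ a 0 ∣ * ∣ a i ∣  ∎

  bounded : ∀ i → ∣ a i ∣ ℚ.≤ ∣ a 0 ∣
  bounded zero    = ≤-refl
  bounded (suc i) = begin
    ∣ a (suc i) ∣      ≤⟨ shrinks i (bounded i) ⟩
    ∣ a 0 ∣ * ∣ a i ∣  ≤⟨ *-mono-≤ (0≤∣p∣ (a i)) 0≤1 (<⇒≤ ∣a₀∣<1) (bounded i) ⟩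
    1ℚ * ∣ a 0 ∣       ≡⟨ *-identityˡ ∣ a 0 ∣ ⟩
    ∣ a 0 ∣            ∎

-- Sums over lists

-- The sum of F x over the entries x of a list, with multiplicity.
∑ : List A → (A → ℚ) → ℚ
∑ xs F = sumℚ (List.map F xs)

∑-cong : {F G : A → ℚ} → (∀ x → F x ≡ G x) → ∀ xs → ∑ xs F ≡ ∑ xs G
∑-cong eq []       = refl
∑-cong eq (x ∷ xs) = cong₂ _+_ (eq x) (∑-cong eq xs)

∑-zero : (xs : List A) → ∑ xs (const 0ℚ) ≡ 0ℚ
∑-zero []       = refl
∑-zero (x ∷ xs) = trans (+-identityˡ _) (∑-zero xs)

∑-+ : (F G : A → ℚ) → ∀ xs → ∑ xs (λ x → F x + G x) ≡ ∑ xs F + ∑ xs G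
∑-+ F G []       = refl
∑-+ F G (x ∷ xs) = trans (cong₂ _+_ (refl {x = F x + G x}) (∑-+ F G xs))
  (solve 4 (λ a b c d → a :+ b :+ (c :+ d) := a :+ c :+ (b :+ d)) refl
     (F x) (G x) (∑ xs F) (∑ xs G))

∑-*ˡ : ∀ c (F : A → ℚ) xs → ∑ xs (λ x → c * F x) ≡ c * ∑ xs F
∑-*ˡ c F []       = sym (*-zeroʳ c)
∑-*ˡ c F (x ∷ xs) =
  trans (cong₂ _+_ (refl {x = c * F x}) (∑-*ˡ c F xs)) (sym (*-distribˡ-+ c (F x) (∑ xs F)))

∑-*ʳ : ∀ c (F : A → ℚ) xs → ∑ xs (λ x → F x * c) ≡ ∑ xs F * c
∑-*ʳ c F xs =
  trans (∑-cong (λ x → *-comm (F x) c) xs) (trans (∑-*ˡ c F xs) (*-comm c (∑ xs F)))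

∑-swap : (F : A → B → ℚ) → ∀ xs ys →
  ∑ xs (λ x → ∑ ys (F x)) ≡ ∑ ys (λ y → ∑ xs (λ x → F x y))
∑-swap F []       ys = sym (∑-zero ys)
∑-swap F (x ∷ xs) ys = trans (cong₂ _+_ (refl {x = ∑ ys (F x)}) (∑-swap F xs ys))
                             (sym (∑-+ (F x) (λ y → ∑ xs (λ x → F x y)) ys))

∑-*-∑ : (F : A → ℚ) (G : B → ℚ) → ∀ xs ys →
  ∑ xs (λ x → ∑ ys (λ y → F x * G y)) ≡ ∑ xs F * ∑ ys G
∑-*-∑ F G xs ys = trans (∑-cong (λ x → ∑-*ˡ (F x) G ys) xs) (∑-*ʳ (∑ ys G) F xs)

∑-++ : (F : A → ℚ) → ∀ xs ys → ∑ (xs ++ ys) F ≡ ∑ xs F + ∑ ys F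
∑-++ F []       ys = sym (+-identityˡ _)
∑-++ F (x ∷ xs) ys = trans (cong₂ _+_ (refl {x = F x}) (∑-++ F xs ys)) (sym (+-assoc (F x) _ _))

∑-cartesianProduct : (F : C → ℚ) (f : A → B → C) → ∀ xs ys →
  ∑ (cartesianProductWith f xs ys) F ≡ ∑ xs (λ x → ∑ ys (λ y → F (f x y)))
∑-cartesianProduct F f []       ys = refl
∑-cartesianProduct F f (x ∷ xs) ys =
  trans (∑-++ F (List.map (f x) ys) _)
        (cong₂ _+_ (cong sumℚ (sym (List.map-∘ ys))) (∑-cartesianProduct F f xs ys))

∑-nonNeg : {F : A → ℚ} → (∀ x → 0ℚ ℚ.≤ F x) → ∀ xs → 0ℚ ℚ.≤ ∑ xs F
∑-nonNeg 0≤F []       = ≤-refl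
∑-nonNeg 0≤F (x ∷ xs) = +-mono-≤ (0≤F x) (∑-nonNeg 0≤F xs)

∑-mono : {F G : A → ℚ} → (∀ x → F x ℚ.≤ G x) → ∀ xs → ∑ xs F ℚ.≤ ∑ xs G
∑-mono F≤G []       = ≤-refl
∑-mono F≤G (x ∷ xs) = +-mono-≤ (F≤G x) (∑-mono F≤G xs)

∑-filter-zero : {P : Pred A 0ℓ} (P? : Decidable P) {F : A → ℚ} →
  (∀ x → P x → F x ≡ 0ℚ) → ∀ xs → ∑ (filter P? xs) F ≡ 0ℚ
∑-filter-zero P? eq []       = refl
∑-filter-zero P? eq (x ∷ xs) with P? x
... | yes Px = trans (cong₂ _+_ (eq x Px) (∑-filter-zero P? eq xs)) refl
... | no  _  = ∑-filter-zero P? eq xs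

⟶-∑ : (F : A → ℕ → ℚ) (L : A → ℚ) → (∀ x → F x ⟶ L x) →
  ∀ xs → (λ i → ∑ xs (λ x → F x i)) ⟶ ∑ xs L
⟶-∑ F L F⟶L []       = ⟶-const {a = const 0ℚ} (0 , λ _ _ → refl)
⟶-∑ F L F⟶L (x ∷ xs) = ⟶-+ {a = F x} {l = L x} {b = λ i → ∑ xs (λ x → F x i)} {m = ∑ xs L}
  (F⟶L x) (⟶-∑ F L F⟶L xs)

-- Sums over all Boolean functions

-- The rational 1 for true and 0 for false.
indicator : Bool → ℚ
indicator b = if b then 1ℚ else 0ℚ

indicator-∧ : ∀ a b → indicator (a ∧ b) ≡ indicator a * indicator b
indicator-∧ true  b = sym (*-identityˡ (indicator b))
indicator-∧ false b = sym (*-zeroˡ (indicator b))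

indicator≤1 : ∀ b → indicator b ℚ.≤ 1ℚ
indicator≤1 true  = ≤-refl
indicator≤1 false = 0≤1

-- Kronecker's delta with respect to pointwise equality.
δ : BoolFun n → BoolFun n → ℚ
δ f g = indicator (does (f ≗? g))

∑-branch : (F : BoolFun (suc n) → ℚ) → ∑ (allBoolFuns (suc n)) F ≡
  ∑ (allBoolFuns n) (λ f₁ → ∑ (allBoolFuns n) (λ f₀ → F (branch f₁ f₀)))
∑-branch {n} F = ∑-cartesianProduct F branch (allBoolFuns n) (allBoolFuns n)

branch-congˡ : {f₁ g₁ f₀ : BoolFun n} → f₁ ≗ g₁ → branch f₁ f₀ ≗ branch g₁ f₀
branch-congˡ eq (true  ∷ x) = eq x
branch-congˡ eq (false ∷ x) = refl

branch-congʳ : {f₁ f₀ g₀ : BoolFun n} → f₀ ≗ g₀ → branch f₁ f₀ ≗ branch f₁ g₀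
branch-congʳ eq (true  ∷ x) = refl
branch-congʳ eq (false ∷ x) = eq x

branch-η : (f : BoolFun (suc n)) → branch (f ∘ (true ∷_)) (f ∘ (false ∷_)) ≗ f
branch-η f (true  ∷ x) = refl
branch-η f (false ∷ x) = refl

-- This expresses that every function is listed exactly once up to pointwise equality.
∑-δ : {F : BoolFun n → ℚ} → F Preserves _≗_ ⟶ _≡_ →
  ∀ f → ∑ (allBoolFuns n) (λ g → δ f g * F g) ≡ F f
∑-δ {zero} {F} F-cong f = trans (base (f [])) (F-cong λ { [] → refl })
  where
  F₀ = F (const false)
  F₁ = F (const true)
  base : ∀ b → indicator (does (b Bool.≟ false)) * F₀ +
               (indicator (does (b Bool.≟ true)) * F₁ + 0ℚ) ≡ F (const b)
  base false = solve 2 (λ x y → con 1ℚ :* x :+ (con 0ℚ :* y :+ con 0ℚ) := x) refl F₀ F₁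
  base true  = solve 2 (λ x y → con 0ℚ :* x :+ (con 1ℚ :* y :+ con 0ℚ) := y) refl F₀ F₁
∑-δ {suc n} {F} F-cong f = begin
  ∑ (allBoolFuns (suc n)) (λ g → δ f g * F g)
    ≡⟨ ∑-branch (λ g → δ f g * F g) ⟩
  ∑ fs (λ g₁ → ∑ fs (λ g₀ → indicator (does (f₁ ≗? g₁) ∧ does (f₀ ≗? g₀)) * F (branch g₁ g₀)))
    ≡⟨ ∑-cong (λ g₁ → ∑-cong (λ g₀ → trans
         (cong (_* F (branch g₁ g₀)) (indicator-∧ (does (f₁ ≗? g₁)) (does (f₀ ≗? g₀))))
         (*-assoc (δ f₁ g₁) (δ f₀ g₀) (F (branch g₁ g₀)))) fs) fs ⟩
  ∑ fs (λ g₁ → ∑ fs (λ g₀ → δ f₁ g₁ * (δ f₀ g₀ * F (branch g₁ g₀))))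
    ≡⟨ ∑-cong (λ g₁ → ∑-*ˡ (δ f₁ g₁) (λ g₀ → δ f₀ g₀ * F (branch g₁ g₀)) fs) fs ⟩
  ∑ fs (λ g₁ → δ f₁ g₁ * ∑ fs (λ g₀ → δ f₀ g₀ * F (branch g₁ g₀)))
    ≡⟨ ∑-cong (λ g₁ → cong (δ f₁ g₁ *_)
         (∑-δ {F = λ g₀ → F (branch g₁ g₀)} (λ eq → F-cong (branch-congʳ eq)) f₀)) fs ⟩
  ∑ fs (λ g₁ → δ f₁ g₁ * F (branch g₁ f₀))
    ≡⟨ ∑-δ {F = λ g₁ → F (branch g₁ f₀)} (λ eq → F-cong (branch-congˡ eq)) f₁ ⟩
  F (branch f₁ f₀)
    ≡⟨ F-cong (branch-η f) ⟩
  F f ∎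
  where
  open ≡-Reasoning
  fs = allBoolFuns n
  f₁ = f ∘ (true ∷_)
  f₀ = f ∘ (false ∷_)

term≤∑ : {F : BoolFun n → ℚ} → F Preserves _≗_ ⟶ _≡_ → (∀ f → 0ℚ ℚ.≤ F f) →
  ∀ f → F f ℚ.≤ ∑ (allBoolFuns n) F
term≤∑ {n} {F} F-cong 0≤F f = begin
  F f                                     ≡⟨ ∑-δ F-cong f ⟨
  ∑ (allBoolFuns n) (λ g → δ f g * F g)   ≤⟨ ∑-mono below (allBoolFuns n) ⟩
  ∑ (allBoolFuns n) F                     ∎
  where
  open ≤-Reasoning
  below : ∀ g → δ f g * F g ℚ.≤ F g
  below g = begin
    δ f g * F g  ≤⟨ *-monoʳ-≤-nonNeg (F g) {{ℚ.nonNegative (0≤F g)}}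
                      (indicator≤1 (does (f ≗? g))) ⟩
    1ℚ * F g     ≡⟨ *-identityˡ (F g) ⟩
    F g          ∎

-- Summation of w over the fibres of h, the fibre over f being weighted with F f.
∑-fibres : {F : BoolFun n → ℚ} → F Preserves _≗_ ⟶ _≡_ →
  (h : A → BoolFun n) (w : A → ℚ) → ∀ xs →
  ∑ (allBoolFuns n) (λ f → F f * ∑ (filter (λ x → h x ≗? f) xs) w) ≡ ∑ xs (λ x → F (h x) * w x)
∑-fibres {n} {F = F} F-cong h w [] =
  trans (∑-cong (λ f → *-zeroʳ (F f)) (allBoolFuns n)) (∑-zero (allBoolFuns n))
∑-fibres {n} {F = F} F-cong h w (x ∷ xs) = begin
  ∑ fs (λ f → F f * ∑ (filter (λ x → h x ≗? f) (x ∷ xs)) w)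
    ≡⟨ ∑-cong (λ f → trans (cong (F f *_) (split f)) (expand f)) fs ⟩
  ∑ fs (λ f → δ (h x) f * F f * w x + F f * rest f)
    ≡⟨ ∑-+ (λ f → δ (h x) f * F f * w x) (λ f → F f * rest f) fs ⟩
  ∑ fs (λ f → δ (h x) f * F f * w x) + ∑ fs (λ f → F f * rest f)
    ≡⟨ cong₂ _+_
         (trans (∑-*ʳ (w x) (λ f → δ (h x) f * F f) fs) (cong (_* w x) (∑-δ F-cong (h x))))
         (∑-fibres F-cong h w xs) ⟩
  F (h x) * w x + ∑ xs (λ x → F (h x) * w x) ∎
  where
  open ≡-Reasoning
  fs = allBoolFuns n
  rest : BoolFun n → ℚ
  rest f = ∑ (filter (λ x → h x ≗? f) xs) w
  split : ∀ f → ∑ (filter (λ x → h x ≗? f) (x ∷ xs)) w ≡ δ (h x) f * w x + rest f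
  split f with does (h x ≗? f)
  ... | true  = cong (_+ rest f) (sym (*-identityˡ (w x)))
  ... | false = solve 2 (λ w s → s := con 0ℚ :* w :+ s) refl (w x) (rest f)
  expand : ∀ f → F f * (δ (h x) f * w x + rest f) ≡ δ (h x) f * F f * w x + F f * rest f
  expand f = solve 4 (λ F d w s → F :* (d :* w :+ s) := d :* F :* w :+ F :* s) refl
               (F f) (δ (h x) f) (w x) (rest f)

-- Characters of the group of Boolean functions

-- The rational (-1)^b.
sign : Bool → ℚ
sign b = if b then - 1ℚ else 1ℚ

sign-xor : ∀ a b → sign (a xor b) ≡ sign a * sign b
sign-xor true  true  = refl
sign-xor true  false = refl
sign-xor false true  = refl
sign-xor false false = refl

∣sign∣ : ∀ b → ∣ sign b ∣ ≡ 1ℚ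
∣sign∣ true  = refl
∣sign∣ false = refl

-- The bilinear form ⟨t,f⟩: the sum modulo 2 of t x ∧ f x over all points x.
pair : BoolFun n → BoolFun n → Bool
pair {zero}  t f = t [] ∧ f []
pair {suc n} t f =
  pair (t ∘ (true ∷_)) (f ∘ (true ∷_)) xor pair (t ∘ (false ∷_)) (f ∘ (false ∷_))

pair-cong : (t : BoolFun n) → pair t Preserves _≗_ ⟶ _≡_
pair-cong {zero}  t eq = cong (t [] ∧_) (eq [])
pair-cong {suc n} t eq = cong₂ _xor_ (pair-cong _ (eq ∘ (true ∷_))) (pair-cong _ (eq ∘ (false ∷_)))

pair-xor : (t f g : BoolFun n) → pair t (λ x → f x xor g x) ≡ pair t f xor pair t g
pair-xor {zero}  t f g = Bool.∧-distribˡ-xor (t []) (f []) (g [])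
pair-xor {suc n} t f g = trans
  (cong₂ _xor_ (pair-xor t₁ (f ∘ (true ∷_)) (g ∘ (true ∷_)))
               (pair-xor t₀ (f ∘ (false ∷_)) (g ∘ (false ∷_))))
  (xor-interchange (pair t₁ (f ∘ (true ∷_))) (pair t₁ (g ∘ (true ∷_))) _ _)
  where
  t₁ = t ∘ (true ∷_)
  t₀ = t ∘ (false ∷_)

pair-falseʳ : (t : BoolFun n) → pair t (const false) ≡ false
pair-falseʳ {zero}  t = Bool.∧-zeroʳ (t [])
pair-falseʳ {suc n} t = cong₂ _xor_ (pair-falseʳ (t ∘ (true ∷_))) (pair-falseʳ (t ∘ (false ∷_)))

pair-falseˡ : (f : BoolFun n) → pair (const false) f ≡ false
pair-falseˡ {zero}  f = refl
pair-falseˡ {suc n} f = cong₂ _xor_ (pair-falseˡ (f ∘ (true ∷_))) (pair-falseˡ (f ∘ (false ∷_)))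

pair-⨁ : (t : BoolFun n) (gs : Vec (BoolFun n) k) →
  pair t (λ x → ⨁ (Vec.map (λ g → g x) gs)) ≡ ⨁ (Vec.map (pair t) gs)
pair-⨁ t []       = pair-falseʳ t
pair-⨁ t (g ∷ gs) = trans (pair-xor t g _) (cong (pair t g xor_) (pair-⨁ t gs))

-- The character of the group of Boolean functions that is indexed by t.
χ : BoolFun n → BoolFun n → ℚ
χ t f = sign (pair t f)

χ-cong : (t : BoolFun n) → χ t Preserves _≗_ ⟶ _≡_
χ-cong t eq = cong sign (pair-cong t eq)

-- The reciprocal of the number 2 ^ 2 ^ n of n-adic Boolean functions.
weight : ℕ → ℚ
weight zero    = ½
weight (suc n) = weight n * weight n

∣weight∣≤1 : ∀ n → ∣ weight n ∣ ℚ.≤ 1ℚ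
∣weight∣≤1 zero    = ≤ᵇ⇒≤ _
∣weight∣≤1 (suc n) = ≤-trans (≤-reflexive (∣p*q∣≡∣p∣*∣q∣ (weight n) (weight n)))
  (*-mono-≤ (0≤∣p∣ (weight n)) 0≤1 (∣weight∣≤1 n) (∣weight∣≤1 n))

χ-orthogonal : (f g : BoolFun n) →
  weight n * ∑ (allBoolFuns n) (λ t → χ t f * χ t g) ≡ δ f g
χ-orthogonal {zero} f g = base (f []) (g [])
  where
  base : ∀ a b →
    ½ * (sign false * sign false + (sign a * sign b + 0ℚ)) ≡ indicator (does (a Bool.≟ b))
  base true  true  = refl
  base true  false = refl
  base false true  = refl
  base false false = refl
χ-orthogonal {suc n} f g = begin
  w * w * ∑ (allBoolFuns (suc n)) (λ t → χ t f * χ t g)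
    ≡⟨ cong (w * w *_) (trans (∑-branch (λ t → χ t f * χ t g))
         (∑-cong (λ t₁ → ∑-cong (λ t₀ → split t₁ t₀) ts) ts)) ⟩
  w * w * ∑ ts (λ t₁ → ∑ ts (λ t₀ → χ t₁ f₁ * χ t₁ g₁ * (χ t₀ f₀ * χ t₀ g₀)))
    ≡⟨ cong (w * w *_) (∑-*-∑ (λ t → χ t f₁ * χ t g₁) (λ t → χ t f₀ * χ t g₀) ts ts) ⟩
  w * w * (s₁ * s₀)
    ≡⟨ solve 3 (λ w a b → w :* w :* (a :* b) := w :* a :* (w :* b)) refl w s₁ s₀ ⟩
  w * s₁ * (w * s₀)
    ≡⟨ cong₂ _*_ (χ-orthogonal f₁ g₁) (χ-orthogonal f₀ g₀) ⟩
  δ f₁ g₁ * δ f₀ g₀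
    ≡⟨ indicator-∧ (does (f₁ ≗? g₁)) (does (f₀ ≗? g₀)) ⟨
  δ f g ∎
  where
  open ≡-Reasoning
  w  = weight n
  ts = allBoolFuns n
  f₁ = f ∘ (true ∷_)
  f₀ = f ∘ (false ∷_)
  g₁ = g ∘ (true ∷_)
  g₀ = g ∘ (false ∷_)
  s₁ = ∑ ts (λ t → χ t f₁ * χ t g₁)
  s₀ = ∑ ts (λ t → χ t f₀ * χ t g₀)
  split : ∀ t₁ t₀ → χ (branch t₁ t₀) f * χ (branch t₁ t₀) g ≡
                    χ t₁ f₁ * χ t₁ g₁ * (χ t₀ f₀ * χ t₀ g₀)
  split t₁ t₀ = trans
    (cong₂ _*_ (sign-xor (pair t₁ f₁) (pair t₀ f₀)) (sign-xor (pair t₁ g₁) (pair t₀ g₀)))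
    (solve 4 (λ a b c d → a :* b :* (c :* d) := a :* c :* (b :* d)) refl
       (χ t₁ f₁) (χ t₀ f₀) (χ t₁ g₁) (χ t₀ g₀))

-- The Walsh transform

-- The Fourier coefficient of p at the character χ t.
walsh : Mass n → BoolFun n → ℚ
walsh {n} p t = ∑ (allBoolFuns n) (λ f → χ t f * p f)

-- The mass with Fourier coefficients L.
inverseWalsh : (BoolFun n → ℚ) → Mass n
inverseWalsh {n} L f = weight n * ∑ (allBoolFuns n) (λ t → χ t f * L t)

inversion : {p : Mass n} → p Preserves _≗_ ⟶ _≡_ → ∀ f → inverseWalsh (walsh p) f ≡ p f
inversion {n} {p} p-cong f = begin
  w * ∑ fs (λ t → χ t f * ∑ fs (λ g → χ t g * p g))
    ≡⟨ cong (w *_) (∑-cong (λ t → trans (sym (∑-*ˡ (χ t f) (λ g → χ t g * p g) fs))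
         (∑-cong (λ g → sym (*-assoc (χ t f) (χ t g) (p g))) fs)) fs) ⟩
  w * ∑ fs (λ t → ∑ fs (λ g → χ t f * χ t g * p g))
    ≡⟨ cong (w *_) (∑-swap (λ t g → χ t f * χ t g * p g) fs fs) ⟩
  w * ∑ fs (λ g → ∑ fs (λ t → χ t f * χ t g * p g))
    ≡⟨ ∑-*ˡ w (λ g → ∑ fs (λ t → χ t f * χ t g * p g)) fs ⟨
  ∑ fs (λ g → w * ∑ fs (λ t → χ t f * χ t g * p g))
    ≡⟨ ∑-cong (λ g → trans (cong (w *_) (∑-*ʳ (p g) (λ t → χ t f * χ t g) fs))
         (trans (sym (*-assoc w _ (p g))) (cong (_* p g) (χ-orthogonal f g)))) fs ⟩
  ∑ fs (λ g → δ f g * p g)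
    ≡⟨ ∑-δ p-cong f ⟩
  p f ∎
  where
  open ≡-Reasoning
  w  = weight n
  fs = allBoolFuns n

walsh-0 : (p : Mass n) → walsh p (const false) ≡ ∑ (allBoolFuns n) p
walsh-0 {n} p = ∑-cong
  (λ f → trans (cong (λ b → sign b * p f) (pair-falseˡ f)) (*-identityˡ (p f))) (allBoolFuns n)

-- The mass p vanishes outside S. This is stated for the complement of S because membership in S
-- need not be decidable.
SupportedOn : Pred (BoolFun n) 0ℓ → Mass n → Set
SupportedOn S p = ∀ f → f ∉ S → p f ≡ 0ℚ

walsh-constant : ∀ {p : Mass n} {S t d} → IsDistribution p → SupportedOn S p →
  (∀ f → f ∈ S → pair t f ≡ d) → walsh p t ≡ sign d
walsh-constant {n} {p} {S} {t} {d} dist supported pair≡d = begin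
  ∑ fs (λ f → χ t f * p f)   ≡⟨ ∑-cong term fs ⟩
  ∑ fs (λ f → sign d * p f)  ≡⟨ ∑-*ˡ (sign d) p fs ⟩
  sign d * ∑ fs p            ≡⟨ cong (sign d *_) (total dist) ⟩
  sign d * 1ℚ                ≡⟨ *-identityʳ (sign d) ⟩
  sign d                     ∎
  where
  open ≡-Reasoning
  fs = allBoolFuns n
  term : ∀ f → χ t f * p f ≡ sign d * p f
  term f with pair t f Bool.≟ d
  ... | yes eq = cong (λ b → sign b * p f) eq
  ... | no neq = begin
    χ t f * p f   ≡⟨ cong (χ t f *_) p≡0 ⟩
    χ t f * 0ℚ    ≡⟨ trans (*-zeroʳ (χ t f)) (sym (*-zeroʳ (sign d))) ⟩
    sign d * 0ℚ   ≡⟨ cong (sign d *_) p≡0 ⟨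
    sign d * p f  ∎
    where p≡0 = supported f (λ f∈S → neq (pair≡d f f∈S))

-- The difference 1 - sign b * walsh p t is a sum of nonnegative terms, of which that of f is
-- 2 * p f.
signed-walsh<1 : ∀ {p : Mass n} {t f} → IsDistribution p → f ∈ supp p →
  ∀ b → pair t f ≡ not b → sign b * walsh p t < 1ℚ
signed-walsh<1 {n} {p} {t} {f} dist 0<pf b eq = begin-strict
  h                            ≡⟨ +-identityˡ h ⟨
  0ℚ + h                       <⟨ +-monoˡ-< h (<-≤-trans 0<deficit below) ⟩
  ∑ fs deficit + h             ≡⟨ cong (_+ h) ∑-deficit ⟩
  1ℚ + - s * walsh p t + h     ≡⟨ solve 2 (λ s x → con 1ℚ :+ (:- s) :* x :+ s :* x := con 1ℚ)
                                    refl s (walsh p t) ⟩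
  1ℚ                           ∎
  where
  open ≤-Reasoning
  fs = allBoolFuns n
  s  = sign b
  h  = s * walsh p t
  deficit : BoolFun n → ℚ
  deficit g = (1ℚ - s * χ t g) * p g

  0≤deficit : ∀ g → 0ℚ ℚ.≤ deficit g
  0≤deficit g = *-nonNeg (factor b (pair t g)) (nonNegative dist g)
    where
    factor : ∀ b a → 0ℚ ℚ.≤ 1ℚ - sign b * sign a
    factor true  true  = ≤-refl
    factor true  false = nonNegative⁻¹ _
    factor false true  = nonNegative⁻¹ _
    factor false false = ≤-refl

  below : deficit f ℚ.≤ ∑ fs deficit
  below = term≤∑
    (λ eq → cong₂ (λ x y → (1ℚ - s * x) * y) (χ-cong t eq) (respects-≗ dist eq)) 0≤deficit f

  0<deficit : 0ℚ < deficit f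
  0<deficit = *-pos (subst (λ a → 0ℚ < 1ℚ - sign b * sign a) (sym eq) (factor b)) 0<pf
    where
    factor : ∀ b → 0ℚ < 1ℚ - sign b * sign (not b)
    factor true  = positive⁻¹ _
    factor false = positive⁻¹ _

  ∑-deficit : ∑ fs deficit ≡ 1ℚ + - s * walsh p t
  ∑-deficit = trans
    (∑-cong (λ g → solve 3 (λ s x y → (con 1ℚ :- s :* x) :* y := y :+ (:- s) :* (x :* y)) refl
                     s (χ t g) (p g)) fs)
    (trans (∑-+ p (λ g → - s * (χ t g * p g)) fs)
           (cong₂ _+_ (total dist) (∑-*ˡ (- s) (λ g → χ t g * p g) fs)))

∣walsh∣<1 : ∀ {p : Mass n} {t f g} → IsDistribution p → f ∈ supp p → g ∈ supp p →
  pair t f ≢ pair t g → ∣ walsh p t ∣ < 1ℚ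
∣walsh∣<1 {n} {p} {t} {f} {g} dist f∈ g∈ differ = by-values (pair t f) (pair t g) refl refl
  where
  two-sided : ∀ {f g} → f ∈ supp p → pair t f ≡ true → g ∈ supp p → pair t g ≡ false →
    ∣ walsh p t ∣ < 1ℚ
  two-sided f∈ eqf g∈ eqg = ∣p∣<r
    (subst (_< 1ℚ) (*-identityˡ _) (signed-walsh<1 dist f∈ false eqf))
    (subst (_< 1ℚ) (solve 1 (λ x → (:- con 1ℚ) :* x := :- x) refl (walsh p t))
      (signed-walsh<1 dist g∈ true eqg))

  by-values : ∀ a b → pair t f ≡ a → pair t g ≡ b → ∣ walsh p t ∣ < 1ℚ
  by-values true  false eqf eqg = two-sided f∈ eqf g∈ eqg
  by-values false true  eqf eqg = two-sided g∈ eqg f∈ eqf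
  by-values true  true  eqf eqg = contradiction (trans eqf (sym eqg)) differ
  by-values false false eqf eqg = contradiction (trans eqf (sym eqg)) differ

-- Convergence to a uniform distribution

-- A sequence of distributions that is eventually supported on S converges to the uniform
-- distribution on S if every character that is not constant on S has Fourier coefficients
-- tending to 0.
module _ (p : ℕ → Mass n) (dist : ∀ i → IsDistribution (p i))
         (S : Pred (BoolFun n) 0ℓ) (supported : Eventually (λ i → SupportedOn S (p i)))
         (dichotomy : ∀ t → ((λ i → walsh (p i) t) ⟶ 0ℚ) ⊎
                            (∃ λ d → ∀ f → f ∈ S → pair t f ≡ d)) where

  private
    fs = allBoolFuns n

    L : BoolFun n → ℚ
    L t = [ const 0ℚ , sign ∘ proj₁ ]′ (dichotomy t)

    walsh⟶L : ∀ t → (λ i → walsh (p i) t) ⟶ L t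
    walsh⟶L t with dichotomy t
    ... | inj₁ walsh⟶0      = walsh⟶0
    ... | inj₂ (d , pair≡d) = ⟶-const {a = λ i → walsh (p i) t}
      (proj₁ supported , λ i N≤i → walsh-constant (dist i) (proj₂ supported i N≤i) pair≡d)

    π : Mass n
    π = inverseWalsh L

    p⟶π : ∀ f → (λ i → p i f) ⟶ π f
    p⟶π f = ⟶-cong {a = λ i → inverseWalsh (walsh (p i)) f}
      (λ i → inversion (respects-≗ (dist i)) f)
      (⟶-*-bounded {a = λ i → ∑ fs (λ t → χ t f * walsh (p i) t)} {l = ∑ fs (λ t → χ t f * L t)}
        (weight n) (∣weight∣≤1 n)
        (⟶-∑ (λ t i → χ t f * walsh (p i) t) (λ t → χ t f * L t)
          (λ t → ⟶-*-bounded {a = λ i → walsh (p i) t} {l = L t}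
            (χ t f) (≤-reflexive (∣sign∣ (pair t f))) (walsh⟶L t)) fs))

    π-cong : π Preserves _≗_ ⟶ _≡_
    π-cong eq = cong (weight n *_) (∑-cong (λ t → cong (_* L t) (χ-cong t eq)) fs)

    π-constant : ∀ {f g} → f ∈ S → g ∈ S → π f ≡ π g
    π-constant {f} {g} f∈S g∈S = cong (weight n *_) (∑-cong term fs)
      where
      term : ∀ t → χ t f * L t ≡ χ t g * L t
      term t with dichotomy t
      ... | inj₁ _            = trans (*-zeroʳ (χ t f)) (sym (*-zeroʳ (χ t g)))
      ... | inj₂ (d , pair≡d) =
        cong (λ b → sign b * sign d) (trans (pair≡d f f∈S) (sym (pair≡d g g∈S)))

  spectral-limit : ∃ λ π → (∀ f → (λ i → p i f) ⟶ π f) × IsUniformOn S π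
  spectral-limit = π , p⟶π , record
    { isDistribution = record
      { respects-≗  = π-cong
      ; nonNegative = λ f → limit-nonNeg {a = λ i → p i f} (λ i → nonNegative (dist i) f) (p⟶π f)
      ; total       = limit-of-const {a = λ i → ∑ fs (p i)} (0 , λ i _ → total (dist i))
                        (⟶-∑ (λ f i → p i f) π p⟶π fs)
      }
    ; constant = π-constant
    ; outside  = λ {f} f∉S → limit-of-const {a = λ i → p i f}
                   (proj₁ supported , λ i N≤i → proj₂ supported i N≤i f f∉S) (p⟶π f)
    }

-- Tuples of independent functions

∑-tuples : (φ : BoolFun n → Bool) (p : Mass n) → ∀ k xs →
  ∑ (tuples k xs) (λ gs → sign (⨁ (Vec.map φ gs)) * tupleProbability p gs) ≡
  ∑ xs (λ g → sign (φ g) * p g) ^ k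
∑-tuples φ p zero    xs = refl
∑-tuples φ p (suc k) xs = begin
  ∑ (tuples (suc k) xs) (λ gs → sgn gs * prob gs)
    ≡⟨ ∑-cartesianProduct (λ gs → sgn gs * prob gs) _∷_ xs (tuples k xs) ⟩
  ∑ xs (λ g → ∑ (tuples k xs) (λ gs → sgn (g ∷ gs) * (p g * prob gs)))
    ≡⟨ ∑-cong (λ g → ∑-cong (split g) (tuples k xs)) xs ⟩
  ∑ xs (λ g → ∑ (tuples k xs) (λ gs → sign (φ g) * p g * (sgn gs * prob gs)))
    ≡⟨ ∑-*-∑ (λ g → sign (φ g) * p g) (λ gs → sgn gs * prob gs) xs (tuples k xs) ⟩
  ∑ xs (λ g → sign (φ g) * p g) * ∑ (tuples k xs) (λ gs → sgn gs * prob gs)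
    ≡⟨ cong (∑ xs (λ g → sign (φ g) * p g) *_) (∑-tuples φ p k xs) ⟩
  ∑ xs (λ g → sign (φ g) * p g) ^ suc k ∎
  where
  open ≡-Reasoning
  sgn prob : ∀ {k} → Vec (BoolFun _) k → ℚ
  sgn gs  = sign (⨁ (Vec.map φ gs))
  prob gs = tupleProbability p gs
  split : ∀ g (gs : Vec (BoolFun _) k) →
    sgn (g ∷ gs) * (p g * prob gs) ≡ sign (φ g) * p g * (sgn gs * prob gs)
  split g gs = trans (cong (_* (p g * prob gs)) (sign-xor (φ g) (⨁ (Vec.map φ gs))))
    (solve 4 (λ a b c d → a :* b :* (c :* d) := a :* c :* (b :* d)) refl
       (sign (φ g)) (sgn gs) (p g) (prob gs))

tupleProbability-nonNeg : {p : Mass n} → (∀ f → 0ℚ ℚ.≤ p f) →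
  (gs : Vec (BoolFun n) k) → 0ℚ ℚ.≤ tupleProbability p gs
tupleProbability-nonNeg 0≤p []       = 0≤1
tupleProbability-nonNeg 0≤p (g ∷ gs) = *-nonNeg (0≤p g) (tupleProbability-nonNeg 0≤p gs)

tupleProbability-zero : {S : Pred (BoolFun n) 0ℓ} {p : Mass n} → SupportedOn S p →
  (gs : Vec (BoolFun n) k) → ¬ All S gs → tupleProbability p gs ≡ 0ℚ
tupleProbability-zero supported [] ¬all = contradiction [] ¬all
tupleProbability-zero {p = p} supported (g ∷ gs) ¬all with p g ≟ 0ℚ
... | yes pg≡0 = trans (cong (_* tupleProbability p gs) pg≡0) (*-zeroˡ (tupleProbability p gs))
... | no  pg≢0 = trans
  (cong (p g *_) (tupleProbability-zero supported gs
    (λ all → pg≢0 (supported g (λ g∈S → ¬all (g∈S ∷ all))))))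
  (*-zeroʳ (p g))

growth-supported : {S S′ : Pred (BoolFun n) 0ℓ} (μ : Mass n) (α : BoolFun k) → ∀ i →
  (∀ {gs f} → All S gs → compose α gs ≗ f → f ∈ S′) →
  SupportedOn S (growth μ α i) → SupportedOn S′ (growth μ α (suc i))
growth-supported {n} {k} μ α i closed supported f f∉S′ =
  ∑-filter-zero (λ gs → compose α gs ≗? f)
    (λ gs eq → tupleProbability-zero supported gs (λ all → f∉S′ (closed all eq)))
    (tuples k (allBoolFuns n))

-- Affine functions

-- The affine functions for which the parity of the number of variables satisfies P.
AffineWith : Pred Bool 0ℓ → Pred (BoolFun n) 0ℓ
AffineWith P f = ∃₂ λ c₀ c → P (⨁ c) × f ≗ affine c₀ c

⨁-xor : (c d : Vec Bool n) → ⨁ (zipWith _xor_ c d) ≡ ⨁ c xor ⨁ d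
⨁-xor []      []      = refl
⨁-xor (a ∷ c) (b ∷ d) =
  trans (cong ((a xor b) xor_) (⨁-xor c d)) (xor-interchange a b (⨁ c) (⨁ d))

affine-xor : ∀ c₀ (c : Vec Bool n) d₀ d x →
  affine c₀ c x xor affine d₀ d x ≡ affine (c₀ xor d₀) (zipWith _xor_ c d) x
affine-xor c₀ c d₀ d x =
  trans (xor-interchange c₀ _ d₀ _) (cong ((c₀ xor d₀) xor_) (sym (linear c d x)))
  where
  linear : ∀ {n} (c d x : Vec Bool n) →
    ⨁ (zipWith _∧_ (zipWith _xor_ c d) x) ≡ ⨁ (zipWith _∧_ c x) xor ⨁ (zipWith _∧_ d x)
  linear []      []      []      = refl
  linear (a ∷ c) (b ∷ d) (y ∷ x) = trans
    (cong₂ _xor_ (Bool.∧-distribʳ-xor y a b) (linear c d x))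
    (xor-interchange (a ∧ y) (b ∧ y) _ _)

affine-∅ : ∀ c₀ → affine c₀ (∅ {n}) ≗ const c₀
affine-∅ c₀ x = trans (cong (c₀ xor_) (empty x)) (Bool.xor-identityʳ c₀)
  where
  empty : ∀ {n} (x : Vec Bool n) → ⨁ (zipWith _∧_ ∅ x) ≡ false
  empty []      = refl
  empty (_ ∷ x) = empty x

⨁-∅ : ∀ n → ⨁ (∅ {n}) ≡ false
⨁-∅ zero    = refl
⨁-∅ (suc n) = ⨁-∅ n

affine-⁅⁆ : ∀ c₀ (j : Fin n) x → affine c₀ ⁅ j ⁆ x ≡ c₀ xor var j x
affine-⁅⁆ c₀ j x = cong (c₀ xor_) (picks j x)
  where
  picks : ∀ {n} (j : Fin n) x → ⨁ (zipWith _∧_ ⁅ j ⁆ x) ≡ var j x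
  picks zero    (y ∷ x) = trans (cong (y xor_) (affine-∅ false x)) (Bool.xor-identityʳ y)
  picks (suc j) (_ ∷ x) = picks j x

⨁-⁅⁆ : (j : Fin n) → ⨁ ⁅ j ⁆ ≡ true
⨁-⁅⁆ {suc n} zero    = cong not (⨁-∅ n)
⨁-⁅⁆         (suc j) = ⨁-⁅⁆ j

-- The entries of bs are the parities of the numbers of variables of the summands.
⨁-affine : {P : Pred Bool 0ℓ} {gs : Vec (BoolFun n) k} → All (AffineWith P) gs →
  ∃ λ bs → All P bs × AffineWith (_≡ ⨁ {k} bs) (λ x → ⨁ (Vec.map (λ g → g x) gs))
⨁-affine {n} [] = [] , [] , false , ∅ , ⨁-∅ n , λ x → sym (affine-∅ false x)
⨁-affine {gs = g ∷ gs} ((c₀ , c , Pc , g≗) ∷ all) =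
  let bs , Pbs , d₀ , d , ⨁d≡⨁bs , gs≗ = ⨁-affine all in
  ⨁ c ∷ bs , Pc ∷ Pbs , c₀ xor d₀ , zipWith _xor_ c d
  , trans (⨁-xor c d) (cong (⨁ c xor_) ⨁d≡⨁bs)
  , λ x → trans (cong₂ _xor_ (g≗ x) (gs≗ x)) (affine-xor c₀ c d₀ d x)

A₀⇒affine : {f : BoolFun n} → f ∈ A₀ → AffineWith (_≡ true) f ⊎ ∃ λ b → f ≗ const b
A₀⇒affine (inj₁ (j , f≗)) =
  inj₁ (false , ⁅ j ⁆ , ⨁-⁅⁆ j , λ x → trans (f≗ x) (sym (affine-⁅⁆ false j x)))
A₀⇒affine (inj₂ (inj₁ (j , f≗))) =
  inj₁ (true , ⁅ j ⁆ , ⨁-⁅⁆ j , λ x → trans (f≗ x) (sym (affine-⁅⁆ true j x)))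
A₀⇒affine (inj₂ (inj₂ f≗)) = inj₂ f≗

-- The pairing with t does not depend on constant terms, and it is a on each variable.
Balanced : BoolFun n → Bool → Set
Balanced t a = pair t (const true) ≡ false × (∀ j → pair t (var j) ≡ a)

pair-const : (t : BoolFun n) → pair t (const true) ≡ false → ∀ b → pair t (const b) ≡ false
pair-const t eq true  = eq
pair-const t eq false = pair-falseʳ t

pair-affine : ∀ {t : BoolFun n} {a} → Balanced t a → ∀ c₀ c → pair t (affine c₀ c) ≡ a ∧ ⨁ c
pair-affine {n} {t} {a} (pair-1 , pair-var) c₀ c = begin
  pair t (affine c₀ c)
    ≡⟨ pair-xor t (const c₀) _ ⟩
  pair t (const c₀) xor pair t (λ x → ⨁ (zipWith _∧_ c x))
    ≡⟨ cong₂ _xor_ (pair-const t pair-1 c₀)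
         (pair-cong t (λ x → cong (λ y → ⨁ (zipWith _∧_ c y)) (sym (Vec.tabulate∘lookup x)))) ⟩
  pair t (λ x → ⨁ (zipWith _∧_ c (tabulate (λ j → var j x))))
    ≡⟨ combination c var pair-var ⟩
  a ∧ ⨁ c ∎
  where
  open ≡-Reasoning
  scaled : ∀ b {h : BoolFun n} → pair t h ≡ a → pair t (λ x → b ∧ h x) ≡ a ∧ b
  scaled true  eq = trans eq (sym (Bool.∧-identityʳ a))
  scaled false eq = trans (pair-falseʳ t) (sym (Bool.∧-zeroʳ a))
  combination : ∀ {m} (c : Vec Bool m) (h : Fin m → BoolFun n) → (∀ j → pair t (h j) ≡ a) →
    pair t (λ x → ⨁ (zipWith _∧_ c (tabulate (λ j → h j x)))) ≡ a ∧ ⨁ c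
  combination []      h eq = trans (pair-falseʳ t) (sym (Bool.∧-zeroʳ a))
  combination (b ∷ c) h eq = trans (pair-xor t (λ x → b ∧ h zero x) _)
    (trans (cong₂ _xor_ (scaled b (eq zero)) (combination c (h ∘ suc) (eq ∘ suc)))
           (sym (Bool.∧-distribˡ-xor a b (⨁ c))))

-- Parity

-- The parity of a natural number, true for odd ones.
odd : ℕ → Bool
odd zero    = false
odd (suc n) = not (odd n)

odd≡false⇒2∣ : ∀ n → odd n ≡ false → 2 ∣ n
odd≡false⇒2∣ zero          _  = 2 ∣0
odd≡false⇒2∣ (suc (suc n)) eq =
  ∣m∣n⇒∣m+n ∣-refl (odd≡false⇒2∣ n (trans (sym (Bool.not-involutive (odd n))) eq))

odd≡true⇒2∤ : ∀ n → odd n ≡ true → 2 ∤ n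
odd≡true⇒2∤ (suc zero)    _  2∣1 = contradiction (∣⇒≤ 2∣1) λ { (s≤s ()) }
odd≡true⇒2∤ (suc (suc n)) eq 2∣n =
  odd≡true⇒2∤ n (trans (sym (Bool.not-involutive (odd n))) eq) (∣m+n∣m⇒∣n 2∣n ∣-refl)

2∣⇒odd≡false : ∀ n → 2 ∣ n → odd n ≡ false
2∣⇒odd≡false n 2∣n with odd n in eq
... | false = refl
... | true  = contradiction 2∣n (odd≡true⇒2∤ n eq)

2∤⇒odd≡true : ∀ n → 2 ∤ n → odd n ≡ true
2∤⇒odd≡true n 2∤n with odd n in eq
... | true  = refl
... | false = contradiction (odd≡false⇒2∣ n eq) 2∤n

⨁≡odd : (c : Vec Bool n) → ⨁ c ≡ odd ∣ c ∣ˢ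
⨁≡odd []          = refl
⨁≡odd (true  ∷ c) = cong not (⨁≡odd c)
⨁≡odd (false ∷ c) = ⨁≡odd c

⨁-trues : {bs : Vec Bool k} → All (_≡ true) bs → ⨁ bs ≡ odd k
⨁-trues []           = refl
⨁-trues (refl ∷ all) = cong not (⨁-trues all)

⨁-falses : {bs : Vec Bool k} → All (_≡ false) bs → ⨁ bs ≡ false
⨁-falses []           = refl
⨁-falses (refl ∷ all) = ⨁-falses all

-- Growth under a linear connective

module LinearGrowth (c : Bool) (α : BoolFun k) (α-linear : ∀ y → α y ≡ c xor ⨁ y)
                    (μ : Mass n) (μ-dist : IsDistribution μ) where

  -- The sum over f of χ t f times the mass of the fibre over f is a sum over all tuples, which
  -- factors because χ t is multiplicative and the entries of a tuple are independent.
  walsh-growth : ∀ i t →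
    walsh (growth μ α (suc i)) t ≡ χ t (const c) * walsh (growth μ α i) t ^ k
  walsh-growth i t = begin
    ∑ fs (λ f → χ t f * ∑ (filter (λ gs → compose α gs ≗? f) gss) prob)
      ≡⟨ ∑-fibres (χ-cong t) (compose α) prob gss ⟩
    ∑ gss (λ gs → χ t (compose α gs) * prob gs)
      ≡⟨ ∑-cong (λ gs → trans (cong (_* prob gs) (χ-compose gs))
           (*-assoc (χ t (const c)) (sgn gs) (prob gs))) gss ⟩
    ∑ gss (λ gs → χ t (const c) * (sgn gs * prob gs))
      ≡⟨ ∑-*ˡ (χ t (const c)) (λ gs → sgn gs * prob gs) gss ⟩
    χ t (const c) * ∑ gss (λ gs → sgn gs * prob gs)
      ≡⟨ cong (χ t (const c) *_) (∑-tuples (pair t) (growth μ α i) k fs) ⟩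
    χ t (const c) * walsh (growth μ α i) t ^ k ∎
    where
    open ≡-Reasoning
    fs  = allBoolFuns n
    gss = tuples k fs
    sgn prob : Vec (BoolFun n) k → ℚ
    sgn gs  = sign (⨁ (Vec.map (pair t) gs))
    prob gs = tupleProbability (growth μ α i) gs
    χ-compose : ∀ gs → χ t (compose α gs) ≡ χ t (const c) * sgn gs
    χ-compose gs = trans
      (cong sign (trans (pair-cong t (λ x → α-linear (Vec.map (λ g → g x) gs)))
        (trans (pair-xor t (const c) _) (cong (pair t (const c) xor_) (pair-⨁ t gs)))))
      (sign-xor (pair t (const c)) _)

  growth-dist : ∀ i → IsDistribution (growth μ α i)
  growth-dist zero    = μ-dist
  growth-dist (suc i) = record
    { respects-≗  = λ {f} {g} f≗g → cong (λ gss → ∑ gss prob)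
        (List.filter-≐ (λ gs → compose α gs ≗? f) (λ gs → compose α gs ≗? g)
          ( (λ eq x → trans (eq x) (f≗g x)) , (λ eq x → trans (eq x) (sym (f≗g x))))
          (tuples k fs))
    ; nonNegative = λ f → ∑-nonNeg (tupleProbability-nonNeg (nonNegative (growth-dist i)))
        (filter (λ gs → compose α gs ≗? f) (tuples k fs))
    ; total       = begin
        ∑ fs (growth μ α (suc i))
          ≡⟨ walsh-0 (growth μ α (suc i)) ⟨
        walsh (growth μ α (suc i)) (const false)
          ≡⟨ walsh-growth i (const false) ⟩
        χ 0ᶠ (const c) * walsh (growth μ α i) 0ᶠ ^ k
          ≡⟨ cong₂ (λ b x → sign b * x ^ k) (pair-falseˡ {n} (const c))
               (trans (walsh-0 (growth μ α i)) (total (growth-dist i))) ⟩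
        1ℚ * 1ℚ ^ k
          ≡⟨ trans (*-identityˡ _) (1^k≡1 k) ⟩
        1ℚ ∎
    }
    where
    open ≡-Reasoning
    fs = allBoolFuns n
    0ᶠ : BoolFun n
    0ᶠ = const false
    prob : Vec (BoolFun n) k → ℚ
    prob gs = tupleProbability (growth μ α i) gs

  walsh⟶0 : 2 ≤ k → ∀ t → ∣ walsh μ t ∣ < 1ℚ → (λ i → walsh (growth μ α i) t) ⟶ 0ℚ
  walsh⟶0 2≤k t small = power-iteration⟶0 {a = λ i → walsh (growth μ α i) t} 2≤k small λ i →
    let r = walsh (growth μ α i) t ^ k in begin
    ∣ walsh (growth μ α (suc i)) t ∣   ≡⟨ cong ∣_∣ (walsh-growth i t) ⟩
    ∣ χ t (const c) * r ∣              ≡⟨ ∣p*q∣≡∣p∣*∣q∣ (χ t (const c)) r ⟩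
    ∣ χ t (const c) ∣ * ∣ r ∣          ≡⟨ cong (_* ∣ r ∣) (∣sign∣ (pair t (const c))) ⟩
    1ℚ * ∣ r ∣                         ≡⟨ *-identityˡ _ ⟩
    ∣ r ∣                              ∎
    where open ≡-Reasoning

  growth-affine : (P Q : Pred Bool 0ℓ) → (∀ {bs : Vec Bool k} → All P bs → Q (⨁ bs)) → ∀ i →
    SupportedOn (AffineWith P) (growth μ α i) → SupportedOn (AffineWith Q) (growth μ α (suc i))
  growth-affine P Q P⇒Q i = growth-supported μ α i closed
    where
    closed : ∀ {gs f} → All (AffineWith P) gs → compose α gs ≗ f → f ∈ AffineWith Q
    closed {gs} all eq = let bs , Pbs , d₀ , d , ⨁d≡⨁bs , gs≗ = ⨁-affine all in
      c xor d₀ , d , subst Q (sym ⨁d≡⨁bs) (P⇒Q Pbs)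
      , λ x → trans (sym (eq x)) (trans (α-linear (Vec.map (λ g → g x) gs))
               (trans (cong (c xor_) (gs≗ x)) (sym (Bool.xor-assoc c d₀ _))))

  -- By the third component of the second alternative, pairing with t is constant on the target.
  limit-uniform : 2 ≤ k → (P : Pred Bool 0ℓ) →
    Eventually (λ i → SupportedOn (AffineWith P) (growth μ α i)) →
    (∀ t → ∣ walsh μ t ∣ < 1ℚ ⊎ (∃ λ a → Balanced t a × ∃ λ d → ∀ b → P b → a ∧ b ≡ d)) →
    LimitUniformOn (AffineWith P) μ α
  limit-uniform 2≤k P supported spectrum =
    spectral-limit (growth μ α) growth-dist (AffineWith P) supported λ t →
    [ (λ small → inj₁ (walsh⟶0 2≤k t small))
    , (λ (a , balanced , d , a∧≡d) → inj₂ (d , λ f (c₀ , e , Pe , f≗) →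
        trans (pair-cong t f≗) (trans (pair-affine balanced c₀ e) (a∧≡d _ Pe))))
    ]′ (spectrum t)

LimitUniformOn-≐ : {S S′ : Pred (BoolFun n) 0ℓ} {μ : Mass n} {α : BoolFun k} →
  S ⊆ S′ → S′ ⊆ S → LimitUniformOn S μ α → LimitUniformOn S′ μ α
LimitUniformOn-≐ S⊆S′ S′⊆S (π , p⟶π , uniform) = π , p⟶π , record
  { isDistribution = isDistribution
  ; constant       = λ f∈ g∈ → constant (S′⊆S f∈) (S′⊆S g∈)
  ; outside        = λ f∉ → outside (f∉ ∘ S⊆S′)
  }
  where open IsUniformOn uniform

-- The initial distribution

-- The index j₀ witnesses that there is at least one variable.
module Initial (j₀ : Fin n) (μ : Mass n) (μ-initial : IsInitial μ)
               (negVars⊆supp : ∀ j → negVar j ∈ supp μ) where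
  open IsInitial μ-initial
  open IsUniformOn isUniform

  supp⇒¬∉S : ∀ {f} → f ∈ supp μ → ¬ f ∉ S
  supp⇒¬∉S f∈supp f∉S = <-irrefl (sym (outside f∉S)) f∈supp

  supported-A₀ : SupportedOn (λ f → f ∈ A₀ × f ∈ supp μ) μ
  supported-A₀ f f∉ with 0ℚ <? μ f
  ... | yes f∈supp = contradiction (λ f∈S → f∉ (S⊆A₀ f∈S , f∈supp)) (supp⇒¬∉S f∈supp)
  ... | no  f∉supp = ≤-antisym (≮⇒≥ f∉supp) (nonNegative isDistribution f)

  supported-odd : NoConstantInSupport μ → SupportedOn (AffineWith (_≡ true)) μ
  supported-odd noConst f f∉ = supported-A₀ f λ (f∈A₀ , f∈supp) →
    [ f∉
    , (λ (b , f≗) → noConst b (subst (0ℚ <_) (respects-≗ isDistribution f≗) f∈supp))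
    ]′ (A₀⇒affine f∈A₀)

  supported-affine : SupportedOn (AffineWith U) μ
  supported-affine f f∉ = supported-A₀ f λ (f∈A₀ , _) → f∉
    ([ (λ (c₀ , c , _ , f≗) → c₀ , c , tt , f≗)
     , (λ (b , f≗) → b , ∅ , tt , λ x → trans (f≗ x) (sym (affine-∅ b x)))
     ]′ (A₀⇒affine f∈A₀))

  negVars⊆S : ∀ j → negVar j ∈ S
  negVars⊆S j with negVars
  ... | inj₁ neg∈S = neg∈S j
  ... | inj₂ neg∉S = contradiction (neg∉S j) (supp⇒¬∉S (negVars⊆supp j))

  vars⊆supp : ∀ j → var j ∈ supp μ
  vars⊆supp j = subst (0ℚ <_) (constant (negVars⊆S j) (vars j)) (negVars⊆supp j)

  -- If ⟨t,1⟩ is true, then t separates a variable from its negation; otherwise t is balanced or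
  -- separates two variables.
  spectrum : ∀ t → ∣ walsh μ t ∣ < 1ℚ ⊎ ∃ (Balanced t)
  spectrum t with pair t (const true) Bool.≟ false
  ... | no pair-1 = inj₁ (∣walsh∣<1 isDistribution (vars⊆supp j₀) (negVars⊆supp j₀)
    λ eq → Bool.not-¬ refl (trans eq (trans (pair-xor t (const true) (var j₀))
      (cong (_xor pair t (var j₀)) (Bool.¬-not pair-1)))))
  ... | yes pair-1 with Fin.all? (λ j → pair t (var j) Bool.≟ pair t (var j₀))
  ...   | yes same = inj₂ (pair t (var j₀) , pair-1 , same)
  ...   | no ¬same =
    let j , differ = Fin.¬∀⟶∃¬ n _ (λ j → pair t (var j) Bool.≟ pair t (var j₀)) ¬same in
    inj₁ (∣walsh∣<1 isDistribution (vars⊆supp j) (vars⊆supp j₀) differ)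

  constant-in-supp : ¬ NoConstantInSupport μ → ∃ λ b → const b ∈ supp μ
  constant-in-supp someConst with 0ℚ <? μ (const true) | 0ℚ <? μ (const false)
  ... | yes 1∈supp | _          = true , 1∈supp
  ... | no _       | yes 0∈supp = false , 0∈supp
  ... | no 1∉supp  | no 0∉supp  = contradiction (λ { true → 1∉supp ; false → 0∉supp }) someConst

  -- A balanced t that is true on the variables separates them from the constants.
  spectrum-const : ∀ {b} → const b ∈ supp μ → ∀ t → ∣ walsh μ t ∣ < 1ℚ ⊎ Balanced t false
  spectrum-const {b} b∈supp t with spectrum t
  ... | inj₁ small = inj₁ small
  ... | inj₂ (false , balanced) = inj₂ balanced
  ... | inj₂ (true , pair-1 , pair-var) = inj₁ (∣walsh∣<1 isDistribution b∈supp (vars⊆supp j₀)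
    λ eq → contradiction (trans (sym (pair-const t pair-1 b)) (trans eq (pair-var j₀))) λ ())

theorem3p3 : ∀ (n k : ℕ) → 1 ≤ n → 2 ≤ k →
    ∀ (c : Bool) (α : BoolFun k) → (∀ y → α y ≡ c xor ⨁ y) →
    ∀ (μ : Mass n) → IsInitial μ → (∀ j → negVar j ∈ supp μ) →
    (NoConstantInSupport μ → 2 ∤ k → LimitUniformOn OddLinear μ α)
    × (NoConstantInSupport μ → 2 ∣ k → LimitUniformOn EvenLinear μ α)
    × (¬ NoConstantInSupport μ → LimitUniformOn Linear μ α)
theorem3p3 (suc n) k _ 2≤k c α α-linear μ μ-initial negVars⊆supp =
  odd-case , even-case , const-case
  where
  open Initial zero μ μ-initial negVars⊆supp
  open LinearGrowth c α α-linear μ (IsUniformOn.isDistribution (IsInitial.isUniform μ-initial))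

  spectrum-≡ : ∀ e t →
    ∣ walsh μ t ∣ < 1ℚ ⊎ (∃ λ a → Balanced t a × ∃ λ d → ∀ b → b ≡ e → a ∧ b ≡ d)
  spectrum-≡ e t =
    [ inj₁ , (λ (a , balanced) → inj₂ (a , balanced , a ∧ e , λ b → cong (a ∧_))) ]′ (spectrum t)

  odd-case : NoConstantInSupport μ → 2 ∤ k → LimitUniformOn OddLinear μ α
  odd-case noConst 2∤k = LimitUniformOn-≐
    (λ (c₀ , c , eq , f≗) → c₀ , c , odd≡true⇒2∤ ∣ c ∣ˢ (trans (sym (⨁≡odd c)) eq) , f≗)
    (λ (c₀ , c , 2∤c , f≗) → c₀ , c , trans (⨁≡odd c) (2∤⇒odd≡true ∣ c ∣ˢ 2∤c) , f≗)
    (limit-uniform 2≤k (_≡ true) (0 , λ i _ → supported i) (spectrum-≡ true))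
    where
    supported : ∀ i → SupportedOn (AffineWith (_≡ true)) (growth μ α i)
    supported zero    = supported-odd noConst
    supported (suc i) = growth-affine (_≡ true) (_≡ true)
      (λ all → trans (⨁-trues all) (2∤⇒odd≡true k 2∤k)) i (supported i)

  even-case : NoConstantInSupport μ → 2 ∣ k → LimitUniformOn EvenLinear μ α
  even-case noConst 2∣k = LimitUniformOn-≐
    (λ (c₀ , c , eq , f≗) → c₀ , c , odd≡false⇒2∣ ∣ c ∣ˢ (trans (sym (⨁≡odd c)) eq) , f≗)
    (λ (c₀ , c , 2∣c , f≗) → c₀ , c , trans (⨁≡odd c) (2∣⇒odd≡false ∣ c ∣ˢ 2∣c) , f≗)
    (limit-uniform 2≤k (_≡ false) (1 , λ { (suc i) _ → supported i }) (spectrum-≡ false))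
    where
    -- The initial functions have an odd number of variables, so evenness starts at step 1.
    supported : ∀ i → SupportedOn (AffineWith (_≡ false)) (growth μ α (suc i))
    supported zero    = growth-affine (_≡ true) (_≡ false)
      (λ all → trans (⨁-trues all) (2∣⇒odd≡false k 2∣k)) 0 (supported-odd noConst)
    supported (suc i) = growth-affine (_≡ false) (_≡ false) ⨁-falses (suc i) (supported i)

  const-case : ¬ NoConstantInSupport μ → LimitUniformOn Linear μ α
  const-case someConst = LimitUniformOn-≐
    (λ (c₀ , c , _ , f≗) → c₀ , c , f≗)
    (λ (c₀ , c , f≗) → c₀ , c , tt , f≗)
    (limit-uniform 2≤k U (0 , λ i _ → supported i) λ t →
      [ inj₁ , (λ balanced → inj₂ (false , balanced , false , λ _ _ → refl)) ]′
        (spectrum-const (proj₂ (constant-in-supp someConst)) t))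
    where
    supported : ∀ i → SupportedOn (AffineWith U) (growth μ α i)
    supported zero    = supported-affine
    supported (suc i) = growth-affine U U (λ _ → tt) i (supported i)
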